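{- Let $\mathbf T$ be the category whose objects are finite linearly ordered reflexive tournaments and whose morphisms are rigid surjective homomorphisms. Then $\mathbf T$ does not have the dual Ramsey property.
   Context: A linearly ordered reflexive tournament is $(A,\to,\sqsubset)$ where $\sqsubset$ is a (strict) linear order on $A$ and $\to\ \subseteq A^2$ is a reflexive relation such that for all $x\ne y$ in $A$ exactly one of $x\to y$, $y\to x$ holds. A rigid surjective homomorphism from $(A,\to,\sqsubset)$ to $(A',\to',\sqsubset')$ is a surjective map $f:A\to A'$ such that $x\to y$ implies $f(x)\to'f(y)$, and $f:(A,\sqsubset)\to(A',\sqsubset')$ is a rigid surjection, i.e. $\min f^{ -1}(x)\sqsubset\min f^{ -1}(y)$ whenever $x\sqsubset'y$. A category $\mathbf C$ has the dual Ramsey property if for every integer $k\ge2$ and all objects $\mathcal A,\mathcal B$ with $\hom_{\mathbf C}(\mathcal B,\mathcal A)\neq\varnothing$ there is an object $\mathcal C$ such that for every coloring $\chi:\hom_{\mathbf C}(\mathcal C,\mathcal A)\to\{1,\ldots,k\}$ there is $w\in\hom_{\mathbf C}(\mathcal C,\mathcal B)$ such that $\chi$ is constant on $\{f\cdot w: f\in\hom_{\mathbf C}(\mathcal B,\mathcal A)\}$. -}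

module Defs where

open import Level using (Level; _⊔_; 0ℓ) renaming (suc to lsuc)
open import Data.Fin.Base using (Fin)
open import Data.Nat.Base using (ℕ; _≤_)
open import Data.Product using (Σ; ∃; _×_; _,_; proj₁; proj₂)
open import Data.Sum using (_⊎_; inj₁; inj₂)
open import Function.Base using (id; _∘_)
open import Function.Bundles using (_↔_; Func; _⟶ₛ_)
open import Function.Definitions using (Surjective)
import Function.Construct.Composition as Comp
import Function.Construct.Identity as Id
open import Relation.Nullary using (¬_; contradiction)
open import Relation.Binary.Bundles using (Setoid)
open import Relation.Binary.Core using (Rel)
open import Relation.Binary.Definitions using (Reflexive)
open import Relation.Binary.Structures using (IsStrictTotalOrder)
open import Relation.Binary.PropositionalEquality
  using (_≡_; _≢_; _≗_; refl; sym; trans; cong; subst; setoid)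
import Relation.Binary.Construct.StrictToNonStrict as ToNonStrict

record Category (o ℓ e : Level) : Set (lsuc (o ⊔ ℓ ⊔ e)) where
  infixr 9 _·_
  infix  4 _≈_
  field
    Obj : Set o
    Hom : Obj → Obj → Setoid ℓ e

  hom : Obj → Obj → Set ℓ
  hom A B = Setoid.Carrier (Hom A B)

  _≈_ : ∀ {A B} → Rel (hom A B) e
  _≈_ {A} {B} = Setoid._≈_ (Hom A B)

  field
    idₕ       : ∀ {A} → hom A A
    _·_       : ∀ {A B C} → hom B C → hom A B → hom A C
    identityˡ : ∀ {A B} (f : hom A B) → idₕ · f ≈ f
    identityʳ : ∀ {A B} (f : hom A B) → f · idₕ ≈ f
    assoc     : ∀ {A B C D} (h : hom C D) (g : hom B C) (f : hom A B) →
                (h · g) · f ≈ h · (g · f)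
    ·-cong    : ∀ {A B C} {g g′ : hom B C} {f f′ : hom A B} →
                g ≈ g′ → f ≈ f′ → g · f ≈ g′ · f′

-- Colorings are setoid maps: equal morphisms must receive equal colors.
DualRamsey : ∀ {o ℓ e} → Category o ℓ e → Set (o ⊔ ℓ ⊔ e)
DualRamsey 𝐂 =
  ∀ (k : ℕ) → 2 ≤ k → ∀ (A B : Obj) → hom B A →
  Σ Obj λ C → ∀ (χ : Hom C A ⟶ₛ setoid (Fin k)) →
  Σ (hom C B) λ w → ∀ (f g : hom B A) →
  Func.to χ (f · w) ≡ Func.to χ (g · w)
  where open Category 𝐂

record Tournament : Set₁ where
  infix 4 _⟶_ _⊏_
  field
    Carrier    : Set
    _⟶_        : Rel Carrier 0ℓ
    _⊏_        : Rel Carrier 0ℓ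
    finite     : ∃ λ n → Carrier ↔ Fin n
    ⟶-refl     : Reflexive _⟶_
    exactlyOne : ∀ {x y} → x ≢ y →
                 (x ⟶ y × ¬ (y ⟶ x)) ⊎ (¬ (x ⟶ y) × y ⟶ x)
    isStrictTotalOrder : IsStrictTotalOrder _≡_ _⊏_

  open ToNonStrict _≡_ _⊏_ public using () renaming (_≤_ to infix 4 _⊑_)
  module Order = IsStrictTotalOrder isStrictTotalOrder

module _ (𝓐 𝓑 : Tournament) where
  private
    module A = Tournament 𝓐
    module B = Tournament 𝓑

  IsMinOfFibre : (A.Carrier → B.Carrier) → B.Carrier → A.Carrier → Set
  IsMinOfFibre f x m = f m ≡ x × (∀ z → f z ≡ x → m A.⊑ z)

  -- The minima m of f⁻¹(x) and n of f⁻¹(y) are unique, and they exist whenever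
  -- f is surjective, 𝓐 being finite; so ∃ here only names them.
  RigidMap : (A.Carrier → B.Carrier) → Set
  RigidMap f = ∀ {x y} → x B.⊏ y →
    ∃ λ m → ∃ λ n → IsMinOfFibre f x m × IsMinOfFibre f y n × m A.⊏ n

  record RigidSurjHom : Set where
    field
      map        : A.Carrier → B.Carrier
      surjective : Surjective _≡_ _≡_ map
      preserves  : ∀ {x y} → x A.⟶ y → map x B.⟶ map y
      rigid      : RigidMap map

module _ (𝓐 : Tournament) where
  open Tournament 𝓐

  ⊑-refl : ∀ {x} → x ⊑ x
  ⊑-refl = inj₂ refl

  ⊑-trans : ∀ {x y z} → x ⊑ y → y ⊑ z → x ⊑ z
  ⊑-trans (inj₁ p)    (inj₁ q)    = inj₁ (Order.trans p q)
  ⊑-trans (inj₁ p)    (inj₂ refl) = inj₁ p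
  ⊑-trans (inj₂ refl) q           = q

  ⊑-antisym : ∀ {x y} → x ⊑ y → y ⊑ x → x ≡ y
  ⊑-antisym (inj₁ p) (inj₁ q) = contradiction q (Order.asym p)
  ⊑-antisym (inj₁ _) (inj₂ q) = sym q
  ⊑-antisym (inj₂ p) _        = p

  rigid-id : RigidMap 𝓐 𝓐 id
  rigid-id {x} {y} p = x , y
    , (refl , λ z eq → inj₂ (sym eq))
    , (refl , λ z eq → inj₂ (sym eq))
    , p

module _ (𝓐 𝓑 : Tournament) where
  min-unique : ∀ {f x m m′} → IsMinOfFibre 𝓐 𝓑 f x m →
               IsMinOfFibre 𝓐 𝓑 f x m′ → m ≡ m′
  min-unique (p , lo) (p′ , lo′) = ⊑-antisym 𝓐 (lo _ p′) (lo′ _ p)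

module _ (𝓐 𝓑 𝓒 : Tournament) where
  private
    module A = Tournament 𝓐
    module B = Tournament 𝓑
    module C = Tournament 𝓒

  min-∘ : ∀ {f g x b m} → RigidMap 𝓐 𝓑 f →
          IsMinOfFibre 𝓑 𝓒 g x b → IsMinOfFibre 𝓐 𝓑 f b m →
          IsMinOfFibre 𝓐 𝓒 (g ∘ f) x m
  min-∘ {f} {g} {x} {b} {m} rf (gb , lob) (fm , lom) =
    trans (cong g fm) gb , λ z eq → helper z (lob (f z) eq)
    where
    helper : ∀ z → b B.⊑ f z → m A.⊑ z
    helper z (inj₂ b≡fz) = lom z (sym b≡fz)
    helper z (inj₁ b⊏fz) with rf b⊏fz
    ... | m′ , n , minm′ , (_ , lon) , m′⊏n =
      ⊑-trans 𝓐
        (inj₁ (subst (A._⊏ n) (min-unique 𝓐 𝓑 minm′ (fm , lom)) m′⊏n))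
        (lon z refl)

  rigid-∘ : ∀ {f g} → RigidMap 𝓑 𝓒 g → RigidMap 𝓐 𝓑 f →
            RigidMap 𝓐 𝓒 (g ∘ f)
  rigid-∘ rg rf x⊏y with rg x⊏y
  ... | _ , _ , minb , minb′ , b⊏b′ with rf b⊏b′
  ... | m , n , minm , minn , m⊏n =
    m , n , min-∘ rf minb minm , min-∘ rf minb′ minn , m⊏n

𝐓 : Category (lsuc 0ℓ) 0ℓ 0ℓ
𝐓 = record
  { Obj = Tournament
  ; Hom = λ 𝓐 𝓑 → record
    { Carrier = RigidSurjHom 𝓐 𝓑
    ; _≈_     = λ f g → map f ≗ map g
    ; isEquivalence = record
      { refl  = λ _ → refl
      ; sym   = λ p x → sym (p x)
      ; trans = λ p q x → trans (p x) (q x)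
      }
    }
  ; idₕ = λ {𝓐} → record
    { map        = id
    ; surjective = Id.surjective _≡_
    ; preserves  = id
    ; rigid      = rigid-id 𝓐
    }
  ; _·_ = λ {𝓐} {𝓑} {𝓒} g f → record
    { map        = map g ∘ map f
    ; surjective = Comp.surjective _≡_ _≡_ _≡_ (surjective f) (surjective g)
    ; preserves  = preserves g ∘ preserves f
    ; rigid      = rigid-∘ 𝓐 𝓑 𝓒 (rigid g) (rigid f)
    }
  ; identityˡ = λ _ _ → refl
  ; identityʳ = λ _ _ → refl
  ; assoc     = λ _ _ _ _ → refl
  ; ·-cong    = λ {_} {_} {_} {g} {g′} {f} {f′} p q x →
                  trans (p (map f x)) (cong (map g′) (q x))
  }
  where open RigidSurjHom

{-# OPTIONS --safe #-}
module Submission where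

-- A homomorphism pulls a strongly connected part of at least two vertices back to
-- a strongly connected part, and a part that is not strongly connected to one that
-- is not.  Take A = (0 → 1) and B = C₃ ⇒ 3 → 4, where C₃ = {0, 1, 2} is the cyclic
-- triangle, and colour h : C → A by whether h⁻¹(0) is strongly connected in C.
-- The two morphisms B → A with fibres C₃ and C₃ ∪ {3} over 0 then get different
-- colours after composition with any w : C → B.  In preimages of C₃ paths of length
-- three are long enough to join any two vertices, which makes the colouring decidable.

open import Defs
open import Data.Bool.Base using (Bool; true; false; not; T; if_then_else_)
open import Data.Bool.Properties using (T?) renaming (_≟_ to _≟ᵇ_)
open import Data.Fin.Base using (Fin; toℕ; _<_)
open import Data.Fin.Patterns using (0F; 1F; 2F; 3F)
open import Data.Fin.Properties using (_≟_; _<?_; any?; all?; <-isStrictTotalOrder)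
open import Data.Nat.Base using (ℕ; _≤ᵇ_; _<ᵇ_; s≤s; z≤n)
open import Data.Product using (∃; ∃₂; _×_; _,_; proj₂)
open import Data.Sum using (_⊎_; inj₁; inj₂)
open import Data.Unit.Base using (tt)
open import Function.Base using (_∘_)
open import Function.Bundles using (Func; Inverse; _⟶ₛ_; mk⇔)
open import Function.Consequences.Propositional using (strictlySurjective⇒surjective)
open import Function.Construct.Identity using (↔-id)
open import Function.Definitions using (StrictlySurjective)
open import Relation.Binary.PropositionalEquality
  using (_≡_; _≢_; _≗_; refl; sym; trans; cong; subst; setoid)
open import Relation.Nullary using (¬_; Dec; yes; no; contradiction)
open import Relation.Nullary.Decidable
  using (does; from-yes; map′; dec-true; dec-false; does-⇔; ¬?; _×-dec_; _⊎-dec_; _→-dec_)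
open import Relation.Unary using (Pred; Decidable)

open RigidSurjHom

module _ (𝓒 : Tournament) where
  open Tournament 𝓒
  open Inverse (proj₂ finite) using (to; from; strictlyInverseʳ)

  _⟶?_ : ∀ x y → Dec (x ⟶ y)
  x ⟶? y with x Order.≟ y
  ... | yes refl = yes ⟶-refl
  ... | no  x≢y with exactlyOne x≢y
  ...   | inj₁ (x⟶y , _)  = yes x⟶y
  ...   | inj₂ (x⟶̸y , _) = no x⟶̸y

  anyVertex? : ∀ {p} {P : Pred Carrier p} → Decidable P → Dec (∃ P)
  anyVertex? {P = P} P? =
    map′ (λ (i , p) → from i , p)
         (λ (x , p) → to x , subst P (sym (strictlyInverseʳ x)) p)
         (any? (P? ∘ from))

  allVertices? : ∀ {p} {P : Pred Carrier p} → Decidable P → Dec (∀ x → P x)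
  allVertices? {P = P} P? =
    map′ (λ p x → subst P (strictlyInverseʳ x) (p (to x)))
         (λ p i → p (from i))
         (all? (P? ∘ from))

  -- Loops count as arcs, so this covers every walk of at most three proper arcs.
  ThreeStep : Carrier → Carrier → Set
  ThreeStep x y = ∃₂ λ u v → x ⟶ u × u ⟶ v × v ⟶ y

  threeStep? : ∀ x y → Dec (ThreeStep x y)
  threeStep? x y = anyVertex? λ u → anyVertex? λ v →
    (x ⟶? u) ×-dec (u ⟶? v) ×-dec (v ⟶? y)

  -- The inner vertices of the walks range over all of `𝓒`: for a homomorphism `h` to `𝓐`, a walk
  -- ending over `0F` lies entirely over `0F`, as `𝓐` has no arc from `1F` to `0F`.
  StrongOverZero : (Carrier → Fin 2) → Set
  StrongOverZero h = ∀ x y → h x ≡ 0F → h y ≡ 0F → ThreeStep x y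

  strongOverZero? : Decidable StrongOverZero
  strongOverZero? h = allVertices? λ x → allVertices? λ y →
    (h x ≟ 0F) →-dec ((h y ≟ 0F) →-dec threeStep? x y)

  strongOverZero-resp : ∀ {g h} → g ≗ h → StrongOverZero g → StrongOverZero h
  strongOverZero-resp g≗h s x y hx hy =
    s x y (trans (g≗h x) hx) (trans (g≗h y) hy)

module _ {𝓒 𝓑 : Tournament} (w : RigidSurjHom 𝓒 𝓑) where
  private
    module C = Tournament 𝓒
    module B = Tournament 𝓑

  -- One of the two arcs between `x` and `y` is present, and `y ⟶ x` would be mapped to the excluded
  -- arc; reflexivity of `𝓑` rules out `x ≡ y`. Any choice of preimages is therefore joined in the
  -- right direction.
  reflects-strict : ∀ {x y} → ¬ (map w y B.⟶ map w x) → x C.⟶ y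
  reflects-strict {x} {y} y⟶̸x with C.exactlyOne {x} {y} (λ { refl → y⟶̸x B.⟶-refl })
  ... | inj₁ (x⟶y , _) = x⟶y
  ... | inj₂ (_ , y⟶x) = contradiction (preserves w y⟶x) y⟶̸x

-- A Boolean relation lets evaluation settle the axioms for concrete tournaments.
finTournament : ∀ {n} (r : Fin n → Fin n → Bool) → (∀ x → T (r x x)) →
                (∀ x y → x ≢ y → r y x ≡ not (r x y)) → Tournament
finTournament {n} r r-refl r-flip = record
  { Carrier            = Fin n
  ; _⟶_                = λ x y → T (r x y)
  ; _⊏_                = _<_
  ; finite             = n , ↔-id (Fin n)
  ; ⟶-refl             = λ {x} → r-refl x
  ; exactlyOne         = λ {x} {y} x≢y → split x y (r-flip x y x≢y)
  ; isStrictTotalOrder = <-isStrictTotalOrder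
  }
  where
  split : ∀ x y → r y x ≡ not (r x y) →
          (T (r x y) × ¬ T (r y x)) ⊎ (¬ T (r x y) × T (r y x))
  split x y eq with r x y | r y x
  split x y refl | true  | .false = inj₁ (tt , λ ())
  split x y refl | false | .true  = inj₂ ((λ ()) , tt)

arrow : Fin 2 → Fin 2 → Bool
arrow x y = toℕ x ≤ᵇ toℕ y

𝓐 : Tournament
𝓐 = finTournament arrow
  (from-yes (all? λ x → T? (arrow x x)))
  (from-yes (all? λ x → all? λ y → ¬? (x ≟ y) →-dec (arrow y x ≟ᵇ not (arrow x y))))

-- The natural order with the pair `0F`, `2F` reversed, which closes the cycle 0 → 1 → 2 → 0. Vertex
-- 4 keeps the fibre of `cut 4` over `1F` nonempty.
beats : Fin 5 → Fin 5 → Bool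
beats 0F 2F = false
beats 2F 0F = true
beats x  y  = toℕ x ≤ᵇ toℕ y

𝓑 : Tournament
𝓑 = finTournament beats
  (from-yes (all? λ x → T? (beats x x)))
  (from-yes (all? λ x → all? λ y → ¬? (x ≟ y) →-dec (beats y x ≟ᵇ not (beats x y))))

cut : ℕ → Fin 5 → Fin 2
cut k x = if toℕ x <ᵇ k then 0F else 1F

minOfFibre? : ∀ f x m → Dec (IsMinOfFibre 𝓑 𝓐 f x m)
minOfFibre? f x m = (f m ≟ x) ×-dec
  all? λ z → (f z ≟ x) →-dec ((m <? z) ⊎-dec (m ≟ z))

CutPreserves CutRigid : ℕ → Set
CutPreserves k = ∀ x y → T (beats x y) → T (arrow (cut k x) (cut k y))
CutRigid k = ∀ x y → x < y → ∃₂ λ m n →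
  IsMinOfFibre 𝓑 𝓐 (cut k) x m × IsMinOfFibre 𝓑 𝓐 (cut k) y n × m < n

cutSurjective? : ∀ k → Dec (StrictlySurjective _≡_ (cut k))
cutSurjective? k = all? λ y → any? λ x → cut k x ≟ y

cutPreserves? : ∀ k → Dec (CutPreserves k)
cutPreserves? k = all? λ x → all? λ y → T? (beats x y) →-dec T? (arrow (cut k x) (cut k y))

cutRigid? : ∀ k → Dec (CutRigid k)
cutRigid? k = all? λ x → all? λ y → (x <? y) →-dec
  any? λ m → any? λ n →
    minOfFibre? (cut k) x m ×-dec minOfFibre? (cut k) y n ×-dec (m <? n)

cut-hom : ∀ k → StrictlySurjective _≡_ (cut k) → CutPreserves k → CutRigid k →
          RigidSurjHom 𝓑 𝓐
cut-hom k surj pres rig = record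
  { map        = cut k
  ; surjective = strictlySurjective⇒surjective surj
  ; preserves  = λ {x} {y} → pres x y
  ; rigid      = λ {x} {y} → rig x y
  }

cut₃ cut₄ : RigidSurjHom 𝓑 𝓐
cut₃ = cut-hom 3 (from-yes (cutSurjective? 3)) (from-yes (cutPreserves? 3)) (from-yes (cutRigid? 3))
cut₄ = cut-hom 4 (from-yes (cutSurjective? 4)) (from-yes (cutPreserves? 4)) (from-yes (cutRigid? 4))

-- An arc p → q of 𝓑 with p ≠ q, in the form needed for reflects-strict.
Strict : Fin 5 → Fin 5 → Set
Strict p q = ¬ T (beats q p)

strict? : ∀ p q → Dec (Strict p q)
strict? p q = ¬? (T? (beats q p))

-- Distinct vertices of the triangle are one or two arcs apart. For `p ≡ q` the walk goes once
-- around: distinct vertices of `𝓒` over the same `p` must be joined too, and `w` does not control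
-- the arcs inside its fibres. Hence the bound three.
triangle-walks : ∀ p q → cut 3 p ≡ 0F → cut 3 q ≡ 0F →
  Strict p q ⊎ (∃ λ r → Strict p r × Strict r q) ⊎
  (∃₂ λ r s → Strict p r × Strict r s × Strict s q)
triangle-walks = from-yes (all? λ p → all? λ q → (cut 3 p ≟ 0F) →-dec ((cut 3 q ≟ 0F) →-dec
  (strict? p q ⊎-dec (any? λ r → strict? p r ×-dec strict? r q) ⊎-dec
   (any? λ r → any? λ s → strict? p r ×-dec strict? r s ×-dec strict? s q))))

upper-closed : ∀ p q → T (beats p q) → cut 3 p ≡ 1F → cut 3 q ≡ 1F
upper-closed = from-yes (all? λ p → all? λ q →
  T? (beats p q) →-dec ((cut 3 p ≟ 1F) →-dec (cut 3 q ≟ 1F)))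

module _ {𝓒 : Tournament} (w : RigidSurjHom 𝓒 𝓑) where
  open Tournament 𝓒

  preimage : ∀ p → ∃ λ x → map w x ≡ p
  preimage p with surjective w p
  ... | x , wx≡p = x , wx≡p refl

  cut₃-strong : StrongOverZero 𝓒 (cut 3 ∘ map w)
  cut₃-strong x y wx wy with triangle-walks (map w x) (map w y) wx wy
  -- The endpoints are given and inner vertices are arbitrary preimages; loops at `y` pad the
  -- shorter walks.
  ... | inj₁ xy = y , y , reflects-strict w xy , ⟶-refl , ⟶-refl
  ... | inj₂ (inj₁ (r , xr , ry)) with preimage r
  ...   | u , refl = u , y , reflects-strict w xr , reflects-strict w ry , ⟶-refl
  cut₃-strong x y wx wy | inj₂ (inj₂ (r , s , xr , rs , sy)) with preimage r | preimage s
  ...   | u , refl | v , refl =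
    u , v , reflects-strict w xr , reflects-strict w rs , reflects-strict w sy

  cut₄-not-strong : ¬ StrongOverZero 𝓒 (cut 4 ∘ map w)
  -- Both `3F` and `0F` lie over `0F` under `cut 4`, but `cut 3` separates them, and its value `1F`
  -- persists along arcs; so no walk leads from `x` to `y`.
  cut₄-not-strong strong with preimage 3F | preimage 0F
  ... | x , wx | y , wy with strong x y (cong (cut 4) wx) (cong (cut 4) wy)
  ...   | _ , _ , xu , uv , vy = contradiction (trans (sym (cong (cut 3) wy)) y-upper) λ ()
    where
    step : ∀ {a b} → a ⟶ b → cut 3 (map w a) ≡ 1F → cut 3 (map w b) ≡ 1F
    step {a} {b} ab = upper-closed (map w a) (map w b) (preserves w ab)
    y-upper : cut 3 (map w y) ≡ 1F
    y-upper = step vy (step uv (step xu (cong (cut 3) wx)))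

colour : Bool → Fin 2
colour b = if b then 0F else 1F

colouring : ∀ 𝓒 → Category.Hom 𝐓 𝓒 𝓐 ⟶ₛ setoid (Fin 2)
colouring 𝓒 = record
  { to   = λ h → colour (does (strongOverZero? 𝓒 (map h)))
  ; cong = λ {g} {h} g≗h → cong colour (does-⇔
      (mk⇔ (strongOverZero-resp 𝓒 g≗h) (strongOverZero-resp 𝓒 (sym ∘ g≗h)))
      (strongOverZero? 𝓒 (map g)) (strongOverZero? 𝓒 (map h)))
  }

colour-strong : ∀ {𝓒} (h : RigidSurjHom 𝓒 𝓐) → StrongOverZero 𝓒 (map h) →
                Func.to (colouring 𝓒) h ≡ 0F
colour-strong {𝓒} h = cong colour ∘ dec-true (strongOverZero? 𝓒 (map h))

colour-not-strong : ∀ {𝓒} (h : RigidSurjHom 𝓒 𝓐) → ¬ StrongOverZero 𝓒 (map h) →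
                    Func.to (colouring 𝓒) h ≡ 1F
colour-not-strong {𝓒} h = cong colour ∘ dec-false (strongOverZero? 𝓒 (map h))

theorem7p2 : ¬ (DualRamsey 𝐓)
theorem7p2 ramsey =
  -- Two colours suffice; `cut₃` shows that morphisms from `𝓑` to `𝓐` exist.
  let 𝓒 , good = ramsey 2 (s≤s (s≤s z≤n)) 𝓐 𝓑 cut₃
      w , mono = good (colouring 𝓒)
      0≡1 = trans (sym (colour-strong (cut₃ · w) (cut₃-strong w)))
              (trans (mono cut₃ cut₄) (colour-not-strong (cut₄ · w) (cut₄-not-strong w)))
  in contradiction 0≡1 λ ()
  where open Category 𝐓 using (_·_)
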